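{- Let $G$ be a finite almost simple group, let $K$ be a $2$-closed group with $G^*\le K\le\mathrm{Sym}(G)$, and suppose $K$ is of normal type. Let $U/L$ be the principal $K$-section of $G$. Then $K^U\le D(2,U)$.
   Context: $G$ is almost simple if $\mathrm{soc}(G)$ is a nonabelian simple group. For a group $V$ and $L\le V$, $L_{left}$, $L_{right}\le\mathrm{Sym}(V)$ are the groups of permutations $g\mapsto xg$, $g\mapsto gx$ ($x\in L$), $L^*=L_{left}L_{right}$; $D(2,V)\le\mathrm{Sym}(V)$ is generated by $N_{\mathrm{Sym}(V)}(V_{right})$ and $x\mapsto x^{ -1}$. $K$ is $2$-closed if every permutation preserving each orbit of $K$ on $G\times G$ lies in $K$. For $H\subseteq G$, $K^H$ is the group induced on $H$ by the setwise stabilizer of $H$ in $K$. For an imprimitivity system $\mathfrak L$, $K_{\mathfrak L}$ is the subgroup of $K$ fixing each block setwise and $(K_{\mathfrak L})^Z$ its restriction to a union $Z$ of blocks. Principal section: the minimal block $L$ is the intersection of all blocks of imprimitivity of $K$ containing $1$ with more than one element (a normal subgroup of $G$); $\mathfrak L$ is the imprimitivity system containing $L$; for $X,X'\in\mathfrak L$, $X\sim X'$ if both restrictions $(K_{\mathfrak L})^{X\cup X'}\to(K_{\mathfrak L})^X$, $(K_{\mathfrak L})^{X\cup X'}\to(K_{\mathfrak L})^{X'}$ are isomorphisms; $U$ is the union of the $\sim$-class of $L$ (a normal subgroup with $L\trianglelefteq U\trianglelefteq G$). $K$ is of normal type if $L=\mathrm{soc}(L)$ and $K^L\le D(2,L)$.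 -}

module Defs where

open import Data.Nat using (ℕ)
open import Data.Fin using (Fin)
open import Data.Fin.Subset using (Subset; _∈_; _⊆_; ⊤)
open import Data.Product using (Σ; ∃; ∃₂; _×_; _,_)
open import Data.Sum using (_⊎_)
open import Data.Unit using () renaming (⊤ to Unit)
open import Relation.Binary.PropositionalEquality using (_≡_; _≢_)
open import Function using (_∘_; id)

_⇔_ : Set → Set → Set
A ⇔ B = (A → B) × (B → A)

record FinGroup : Set where
  field
    n     : ℕ
    _∙_   : Fin n → Fin n → Fin n
    e     : Fin n
    _⁻¹   : Fin n → Fin n
    assoc : ∀ x y z → (x ∙ y) ∙ z ≡ x ∙ (y ∙ z)
    idˡ   : ∀ x → e ∙ x ≡ x
    idʳ   : ∀ x → x ∙ e ≡ x
    invˡ  : ∀ x → (x ⁻¹) ∙ x ≡ e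
    invʳ  : ∀ x → x ∙ (x ⁻¹) ≡ e

module Over (G : FinGroup) where
  open FinGroup G public

  Carrier : Set
  Carrier = Fin n

  Map : Set
  Map = Carrier → Carrier

  IsSubgroup : Subset n → Set
  IsSubgroup H = e ∈ H
               × (∀ {x y} → x ∈ H → y ∈ H → (x ∙ y) ∈ H)
               × (∀ {x} → x ∈ H → (x ⁻¹) ∈ H)

  IsNormalIn : Subset n → Subset n → Set
  IsNormalIn H N = IsSubgroup N × N ⊆ H
                 × (∀ {h x} → h ∈ H → x ∈ N → ((h ∙ x) ∙ (h ⁻¹)) ∈ N)

  Trivial : Subset n → Set
  Trivial N = ∀ {x} → x ∈ N → x ≡ e

  Nontrivial : Subset n → Set
  Nontrivial N = ∃ λ x → x ∈ N × x ≢ e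

  IsMinimalNormalIn : Subset n → Subset n → Set
  IsMinimalNormalIn H N = IsNormalIn H N × Nontrivial N
                        × (∀ M → IsNormalIn H M → M ⊆ N → Trivial M ⊎ N ⊆ M)

  data ⟨_⟩ (A : Carrier → Set) : Carrier → Set where
    base : ∀ {x} → A x → ⟨ A ⟩ x
    one  : ⟨ A ⟩ e
    mul  : ∀ {x y} → ⟨ A ⟩ x → ⟨ A ⟩ y → ⟨ A ⟩ (x ∙ y)
    inv  : ∀ {x} → ⟨ A ⟩ x → ⟨ A ⟩ (x ⁻¹)

  Soc : Subset n → Carrier → Set
  Soc H = ⟨ (λ y → ∃ λ N → IsMinimalNormalIn H N × y ∈ N) ⟩

  Simple : Subset n → Set
  Simple S = Nontrivial S × (∀ N → IsNormalIn S N → Trivial N ⊎ S ⊆ N)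

  NonabelianSimple : Subset n → Set
  NonabelianSimple S = Simple S
                     × ∃₂ (λ x y → x ∈ S × y ∈ S × (x ∙ y) ≢ (y ∙ x))

  AlmostSimple : Set
  AlmostSimple = Σ (Subset n) λ S → (∀ x → (x ∈ S) ⇔ Soc ⊤ x) × NonabelianSimple S

  _≈[_]_ : Map → (Carrier → Set) → Map → Set
  f ≈[ S ] g = ∀ {x} → S x → f x ≡ g x

  IsPermOn : (Carrier → Set) → Map → Set
  IsPermOn S f = (∀ {x} → S x → S (f x))
               × Σ Map (λ g → (∀ {x} → S x → S (g x))
                              × (g ∘ f) ≈[ S ] id × (f ∘ g) ≈[ S ] id)

  IsPerm : Map → Set
  IsPerm = IsPermOn (λ _ → Unit)

  -- subgroup of Sym(S) generated by Gens (elements compared on S)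
  data Closure (S : Carrier → Set) (Gens : Map → Set) : Map → Set where
    gen  : ∀ {f} → Gens f → Closure S Gens f
    idc  : Closure S Gens id
    comp : ∀ {f g} → Closure S Gens f → Closure S Gens g → Closure S Gens (f ∘ g)
    invc : ∀ {f g} → Closure S Gens f → (∀ {x} → S x → S (g x))
         → (g ∘ f) ≈[ S ] id → (f ∘ g) ≈[ S ] id → Closure S Gens g
    resp : ∀ {f g} → Closure S Gens f → f ≈[ S ] g → Closure S Gens g

  ρ : Carrier → Map
  ρ x g = g ∙ x

  λ′ : Carrier → Map
  λ′ x g = x ∙ g

  NormalizesRight : Subset n → Map → Set
  NormalizesRight L f =
      (∀ {x} → x ∈ L → ∃ λ y → y ∈ L × (f ∘ ρ x) ≈[ (_∈ L) ] (ρ y ∘ f))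
    × (∀ {y} → y ∈ L → ∃ λ x → x ∈ L × (f ∘ ρ x) ≈[ (_∈ L) ] (ρ y ∘ f))

  D2Gen : Subset n → Map → Set
  D2Gen L f = IsPermOn (_∈ L) f × (NormalizesRight L f ⊎ f ≈[ (_∈ L) ] _⁻¹)

  D2 : Subset n → Map → Set
  D2 L = Closure (_∈ L) (D2Gen L)

  Stabilizes : (Carrier → Set) → Map → Set
  Stabilizes S k = ∀ x → S x ⇔ S (k x)

  -- K^S ≤ D : the restriction to S of every k ∈ K with k(S)=S lies in D
  InducedIn : (Map → Set) → (Carrier → Set) → (Map → Set) → Set
  InducedIn K S D = ∀ k → K k → Stabilizes S k → D k

  IsPermGroup : (Map → Set) → Set
  IsPermGroup K = (∀ {f} → K f → IsPerm f)
                × K id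
                × (∀ {f g} → K f → K g → K (f ∘ g))
                × (∀ {f g} → K f → (∀ x → g (f x) ≡ x) → (∀ x → f (g x) ≡ x) → K g)
                × (∀ {f g} → K f → (∀ x → f x ≡ g x) → K g)

  ContainsStar : (Map → Set) → Set
  ContainsStar K = ∀ x y → K (λ′ x ∘ ρ y)

  TwoClosed : (Map → Set) → Set
  TwoClosed K = ∀ σ → IsPerm σ
              → (∀ a b → ∃ λ k → K k × k a ≡ σ a × k b ≡ σ b) → K σ

  IsBlock : (Map → Set) → Subset n → Set
  IsBlock K B = (∃ λ x → x ∈ B)
              × (∀ k → K k → (∃ λ x → x ∈ B × k x ∈ B) → Stabilizes (_∈ B) k)

  IsMinimalBlock : (Map → Set) → Subset n → Set
  IsMinimalBlock K L = ∀ x → (x ∈ L) ⇔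
    (∀ B → IsBlock K B → e ∈ B → (∃₂ λ a b → a ∈ B × b ∈ B × a ≢ b) → x ∈ B)

  -- the block k(L) of the imprimitivity system 𝔏 containing L
  Img : Subset n → Map → Carrier → Set
  Img L k x = ∃ λ y → y ∈ L × k y ≡ x

  InKL : (Map → Set) → Subset n → Map → Set
  InKL K L h = K h × (∀ k → K k → Stabilizes (Img L k) h)

  -- restriction (K_𝔏)^{X ∪ X'} → (K_𝔏)^X is injective (it is onto by definition)
  RestrIso : (Map → Set) → Subset n → (Carrier → Set) → (Carrier → Set) → Set
  RestrIso K L X X' = ∀ h₁ h₂ → InKL K L h₁ → InKL K L h₂
                    → h₁ ≈[ X ] h₂ → h₁ ≈[ (λ x → X x ⊎ X' x) ] h₂

  BlockSim : (Map → Set) → Subset n → Map → Map → Set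
  BlockSim K L k k' = RestrIso K L (Img L k) (Img L k')
                    × RestrIso K L (Img L k') (Img L k)

  IsPrincipalU : (Map → Set) → Subset n → Subset n → Set
  IsPrincipalU K L U = ∀ x → (x ∈ U) ⇔
    (∃ λ k → K k × BlockSim K L k id × Img L k x)

  NormalType : (Map → Set) → Subset n → Set
  NormalType K L = (∀ x → (x ∈ L) ⇔ Soc L x) × InducedIn K (_∈ L) (D2 L)

{-# OPTIONS --safe #-}

-- Left and right multiplications by elements of L lie in K_𝔏, and an element
-- of K_𝔏 is determined on U by its restriction to L.  So if f ∈ K fixes 1 and
-- is an automorphism of L, then f (x u) = f x f u and f (u x) = f u f x for
-- x ∈ L and u ∈ U, because these hold for u ∈ L.  Hence conjugation by f u on
-- L is the f-transport of conjugation by u; as L contains the socle, it has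
-- trivial centralizer, so f u is determined by this action and f is an
-- automorphism of U.  If f is an antiautomorphism of L, apply this to x ↦ (f x)⁻¹.
module Submission where

open import Defs
open import Algebra.Bundles using (Group)
import Algebra.Properties.Group as GroupProperties
open import Data.Fin.Properties using (_≟_; all?; any?)
open import Data.Fin.Subset using (Subset; _∈_; _⊆_; _⊂_; ⊤)
open import Data.Fin.Subset.Induction using (⊂-wellFounded)
open import Data.Fin.Subset.Properties using (_∈?_; ∈⊤)
open import Data.Product using (∃; _×_; _,_; proj₁; proj₂)
open import Data.Sum using (_⊎_; inj₁; inj₂)
open import Data.Unit using (tt)
open import Data.Vec using (tabulate)
open import Data.Vec.Properties using (lookup∘tabulate; lookup⇒[]=; []=⇒lookup)
open import Function using (_∘_; id)
open import Induction.WellFounded using (Acc; acc)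
open import Relation.Binary.PropositionalEquality
  using ( _≡_; _≢_; refl; sym; trans; cong; cong₂; subst; subst₂; isEquivalence
        ; module ≡-Reasoning )
open import Relation.Nullary using (¬_; Dec; yes; no; does)
open import Relation.Nullary.Decidable
  using (_×-dec_; _→-dec_; ¬?; dec-true; decidable-stable)
open import Relation.Unary using (Pred; Decidable)
open ≡-Reasoning

-- Subsets cut out by decidable predicates.

comprehend : ∀ {n p} {P : Pred _ p} → Decidable P → Subset n
comprehend P? = tabulate (does ∘ P?)

∈-comprehend⁺ : ∀ {n p} {P : Pred _ p} (P? : Decidable P) {x} →
                P x → x ∈ comprehend {n} P?
∈-comprehend⁺ P? {x} Px =
  lookup⇒[]= x _ (trans (lookup∘tabulate (does ∘ P?) x) (dec-true (P? x) Px))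

∈-comprehend⁻ : ∀ {n p} {P : Pred _ p} (P? : Decidable P) {x} →
                x ∈ comprehend {n} P? → P x
∈-comprehend⁻ P? {x} x∈
  with P? x | trans (sym (lookup∘tabulate (does ∘ P?) x)) ([]=⇒lookup x∈)
... | yes Px | _ = Px

module _ (G : FinGroup) where
  open Over G

  group : Group _ _
  group = record
    { isGroup = record
      { isMonoid = record
        { isSemigroup = record
          { isMagma = record { isEquivalence = isEquivalence ; ∙-cong = cong₂ _∙_ }
          ; assoc = assoc }
        ; identity = idˡ , idʳ }
      ; inverse = invˡ , invʳ
      ; ⁻¹-cong = cong _⁻¹ } }

  open GroupProperties group
    using (⁻¹-anti-homo-∙; ε⁻¹≈ε; ⁻¹-involutive; ∙-cancelʳ)
    renaming ( \\-leftDividesˡ to x∙x⁻¹∙y≡y; \\-leftDividesʳ to x⁻¹∙x∙y≡y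
             ; //-rightDividesˡ to y∙x⁻¹∙x≡y; //-rightDividesʳ to y∙x∙x⁻¹≡y )

  -- Centralizers of normal subgroups.

  _CommutesWith_ : Carrier → Subset n → Set
  z CommutesWith A = ∀ y → y ∈ A → z ∙ y ≡ y ∙ z

  TrivialCentralizer : Subset n → Set
  TrivialCentralizer A = ∀ z → z CommutesWith A → z ≡ e

  -- Formed as a `Subset` so that `IsNormalIn` applies to it; finiteness of the carrier makes the
  -- universally quantified condition decidable.
  centralizer : Subset n → Subset n
  centralizer A =
    comprehend (λ z → all? (λ y → (y ∈? A) →-dec (z ∙ y ≟ y ∙ z)))

  ∈-centralizer⁺ : ∀ A {z} → z CommutesWith A → z ∈ centralizer A
  ∈-centralizer⁺ A = ∈-comprehend⁺ (λ z → all? (λ y → (y ∈? A) →-dec (z ∙ y ≟ y ∙ z)))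

  ∈-centralizer⁻ : ∀ A {z} → z ∈ centralizer A → z CommutesWith A
  ∈-centralizer⁻ A = ∈-comprehend⁻ (λ z → all? (λ y → (y ∈? A) →-dec (z ∙ y ≟ y ∙ z)))

  conj-of : Carrier → Carrier → Carrier
  conj-of h x = (h ∙ x) ∙ (h ⁻¹)

  conj-slide : ∀ h x → conj-of h x ∙ h ≡ h ∙ x
  conj-slide h x = y∙x⁻¹∙x≡y h (h ∙ x)

  centralizer-normal : ∀ {A} → IsNormalIn ⊤ A → IsNormalIn ⊤ (centralizer A)
  centralizer-normal {A} (_ , _ , A-conj) =
    ( ∈-centralizer⁺ A (λ y _ → trans (idˡ y) (sym (idʳ y)))
    , (λ x∈ y∈ → ∈-centralizer⁺ A (closed (∈-centralizer⁻ A x∈) (∈-centralizer⁻ A y∈)))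
    , (λ x∈ → ∈-centralizer⁺ A (inverse (∈-centralizer⁻ A x∈))))
    , (λ _ → ∈⊤)
    , (λ {h} _ x∈ → ∈-centralizer⁺ A (normal h (∈-centralizer⁻ A x∈)))
    where
    closed : ∀ {x y} → x CommutesWith A → y CommutesWith A → (x ∙ y) CommutesWith A
    closed {x} {y} cx cy a a∈ = begin
      (x ∙ y) ∙ a  ≡⟨ assoc x y a ⟩
      x ∙ (y ∙ a)  ≡⟨ cong (x ∙_) (cy a a∈) ⟩
      x ∙ (a ∙ y)  ≡⟨ assoc x a y ⟨
      (x ∙ a) ∙ y  ≡⟨ cong (_∙ y) (cx a a∈) ⟩
      (a ∙ x) ∙ y  ≡⟨ assoc a x y ⟩
      a ∙ (x ∙ y)  ∎

    inverse : ∀ {x} → x CommutesWith A → (x ⁻¹) CommutesWith A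
    inverse {x} cx a a∈ = begin
      (x ⁻¹) ∙ a                       ≡⟨ cong ((x ⁻¹) ∙_) (y∙x∙x⁻¹≡y x a) ⟨
      (x ⁻¹) ∙ ((a ∙ x) ∙ (x ⁻¹))      ≡⟨ cong (λ t → (x ⁻¹) ∙ (t ∙ (x ⁻¹))) (cx a a∈) ⟨
      (x ⁻¹) ∙ ((x ∙ a) ∙ (x ⁻¹))      ≡⟨ cong ((x ⁻¹) ∙_) (assoc x a (x ⁻¹)) ⟩
      (x ⁻¹) ∙ (x ∙ (a ∙ (x ⁻¹)))      ≡⟨ x⁻¹∙x∙y≡y x _ ⟩
      a ∙ (x ⁻¹)                       ∎

    normal : ∀ h {x} → x CommutesWith A → conj-of h x CommutesWith A
    normal h {x} cx a a∈ = begin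
      ((h ∙ x) ∙ (h ⁻¹)) ∙ a   ≡⟨ assoc (h ∙ x) (h ⁻¹) a ⟩
      (h ∙ x) ∙ ((h ⁻¹) ∙ a)   ≡⟨ cong ((h ∙ x) ∙_) (slide a) ⟩
      (h ∙ x) ∙ (b ∙ (h ⁻¹))   ≡⟨ assoc (h ∙ x) b (h ⁻¹) ⟨
      ((h ∙ x) ∙ b) ∙ (h ⁻¹)   ≡⟨ cong (_∙ (h ⁻¹)) (assoc h x b) ⟩
      (h ∙ (x ∙ b)) ∙ (h ⁻¹)   ≡⟨ cong (λ t → (h ∙ t) ∙ (h ⁻¹)) (cx b b∈) ⟩
      (h ∙ (b ∙ x)) ∙ (h ⁻¹)   ≡⟨ cong (_∙ (h ⁻¹)) (assoc h b x) ⟨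
      ((h ∙ b) ∙ x) ∙ (h ⁻¹)   ≡⟨ cong (λ t → (t ∙ x) ∙ (h ⁻¹)) hb≡ah ⟩
      ((a ∙ h) ∙ x) ∙ (h ⁻¹)   ≡⟨ cong (_∙ (h ⁻¹)) (assoc a h x) ⟩
      (a ∙ (h ∙ x)) ∙ (h ⁻¹)   ≡⟨ assoc a (h ∙ x) (h ⁻¹) ⟩
      a ∙ ((h ∙ x) ∙ (h ⁻¹))   ∎
      where
      -- Normality of `A` keeps `b` in `A`, so `x` commutes with `b`; the relation `h ∙ b ≡ a ∙ h`
      -- carries this back to `a`.
      b : Carrier
      b = conj-of (h ⁻¹) a
      b∈ : b ∈ A
      b∈ = A-conj ∈⊤ a∈
      slide : ∀ c → (h ⁻¹) ∙ c ≡ conj-of (h ⁻¹) c ∙ (h ⁻¹)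
      slide c = sym (conj-slide (h ⁻¹) c)
      hb≡ah : h ∙ b ≡ a ∙ h
      hb≡ah = begin
        h ∙ (((h ⁻¹) ∙ a) ∙ ((h ⁻¹) ⁻¹))  ≡⟨ cong (h ∙_) (assoc (h ⁻¹) a _) ⟩
        h ∙ ((h ⁻¹) ∙ (a ∙ ((h ⁻¹) ⁻¹)))  ≡⟨ x∙x⁻¹∙y≡y h _ ⟩
        a ∙ ((h ⁻¹) ⁻¹)                   ≡⟨ cong (a ∙_) (⁻¹-involutive h) ⟩
        a ∙ h                             ∎

  -- The simple socle inside nontrivial normal subgroups.

  normal-in-⊤⇒normal-in : ∀ {S N} → IsNormalIn ⊤ N → N ⊆ S → IsNormalIn S N
  normal-in-⊤⇒normal-in (sub , _ , conj) N⊆S = sub , N⊆S , λ _ → conj ∈⊤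

  nontrivial? : ∀ M → Dec (Nontrivial M)
  nontrivial? M = any? (λ x → (x ∈? M) ×-dec ¬? (x ≟ e))

  ¬nontrivial⇒trivial : ∀ {M} → ¬ Nontrivial M → Trivial M
  ¬nontrivial⇒trivial ¬nt {x} x∈ = decidable-stable (x ≟ e) (λ x≢e → ¬nt (x , x∈ , x≢e))

  module _ {S : Subset n} (Soc⊆S : ∀ {x} → Soc ⊤ x → x ∈ S) (S-simple : Simple S) where

    -- If the normal subgroup B does not contain S, then by induction no
    -- nontrivial normal M ⊂ B does either, which makes B itself minimal.
    socle⊆normal-acc : ∀ B → Acc _⊂_ B → IsNormalIn ⊤ B → Nontrivial B → S ⊆ B
    socle⊆normal-acc B (acc smaller) B-normal (b , b∈ , b≢e) {x} x∈ =
      decidable-stable (x ∈? B) absurd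
      where
      absurd : ¬ ¬ (x ∈ B)
      absurd x∉B with proj₂ S-simple B (normal-in-⊤⇒normal-in B-normal B⊆S)
        where
        minimal : ∀ M → IsNormalIn ⊤ M → M ⊆ B → Trivial M ⊎ B ⊆ M
        minimal M M-normal M⊆B with nontrivial? M
        ... | no ¬nt = inj₁ (¬nontrivial⇒trivial ¬nt)
        ... | yes nt = inj₂ λ {y} y∈ → decidable-stable (y ∈? M) λ y∉ →
          x∉B (M⊆B (socle⊆normal-acc M (smaller (M⊆B , y , y∈ , y∉)) M-normal nt x∈))
        B⊆S : B ⊆ S
        B⊆S y∈ = Soc⊆S (base (B , (B-normal , (b , b∈ , b≢e) , minimal) , y∈))
      ... | inj₁ B-trivial = b≢e (B-trivial b∈)
      ... | inj₂ S⊆B = x∉B (S⊆B x∈)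

    socle⊆normal : ∀ {B} → IsNormalIn ⊤ B → Nontrivial B → S ⊆ B
    socle⊆normal {B} = socle⊆normal-acc B (⊂-wellFounded B)

    -- A nontrivial centralizer of `A` would be a nontrivial normal subgroup and so contain `S`.
    -- Since `y ∈ S ⊆ A`, the element `x ∈ S` would then commute with `y`.
    normal⊇socle⇒trivialCentralizer :
      ∀ {A x y} → IsNormalIn ⊤ A → S ⊆ A → x ∈ S → y ∈ S → x ∙ y ≢ y ∙ x →
      TrivialCentralizer A
    normal⊇socle⇒trivialCentralizer {A} {x} {y} A-normal S⊆A x∈ y∈ xy≢yx z z-comm =
      decidable-stable (z ≟ e) λ z≢e →
        xy≢yx (∈-centralizer⁻ A
          (socle⊆normal (centralizer-normal A-normal) (z , ∈-centralizer⁺ A z-comm , z≢e) x∈)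
          y (S⊆A y∈))

  -- The heap operation x y⁻¹ z and its relation to D(2,L).

  IsHeapHom IsHeapAntihom : Subset n → Map → Set
  IsHeapHom L f = ∀ {x y z} → x ∈ L → y ∈ L → z ∈ L →
    f ((x ∙ (y ⁻¹)) ∙ z) ≡ (f x ∙ (f y ⁻¹)) ∙ f z
  IsHeapAntihom L f = ∀ {x y z} → x ∈ L → y ∈ L → z ∈ L →
    f ((x ∙ (y ⁻¹)) ∙ z) ≡ (f z ∙ (f y ⁻¹)) ∙ f x

  heap-reverse : ∀ x y z → (((x ∙ (y ⁻¹)) ∙ z) ⁻¹) ≡ ((z ⁻¹) ∙ ((y ⁻¹) ⁻¹)) ∙ (x ⁻¹)
  heap-reverse x y z = begin
    ((x ∙ (y ⁻¹)) ∙ z) ⁻¹                 ≡⟨ ⁻¹-anti-homo-∙ _ z ⟩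
    (z ⁻¹) ∙ ((x ∙ (y ⁻¹)) ⁻¹)            ≡⟨ cong ((z ⁻¹) ∙_) (⁻¹-anti-homo-∙ x (y ⁻¹)) ⟩
    (z ⁻¹) ∙ (((y ⁻¹) ⁻¹) ∙ (x ⁻¹))       ≡⟨ assoc _ _ _ ⟨
    ((z ⁻¹) ∙ ((y ⁻¹) ⁻¹)) ∙ (x ⁻¹)       ∎

  heap-cong : ∀ {x x′ y y′ z z′} → x ≡ x′ → y ≡ y′ → z ≡ z′ →
              (x ∙ (y ⁻¹)) ∙ z ≡ (x′ ∙ (y′ ⁻¹)) ∙ z′
  heap-cong refl refl refl = refl

  module _ {L : Subset n} (L-subgroup : IsSubgroup L) where
    private
      heap-closed : ∀ {x y z} → x ∈ L → y ∈ L → z ∈ L → ((x ∙ (y ⁻¹)) ∙ z) ∈ L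
      heap-closed x∈ y∈ z∈ =
        proj₁ (proj₂ L-subgroup) (proj₁ (proj₂ L-subgroup) x∈ (proj₂ (proj₂ L-subgroup) y∈)) z∈

    -- `f` turns right translation by y⁻¹ z into right translation by some `w`. Evaluation at `y`
    -- gives w = (f y)⁻¹ (f z), and evaluation at `x` gives the claim.
    normalizesRight⇒heapHom : ∀ {f} → NormalizesRight L f → IsHeapHom L f
    normalizesRight⇒heapHom {f} (forth , _) {x} {y} {z} x∈ y∈ z∈
      with forth (proj₁ (proj₂ L-subgroup) (proj₂ (proj₂ L-subgroup) y∈) z∈)
    ... | w , _ , f-shift = begin
      f ((x ∙ (y ⁻¹)) ∙ z)         ≡⟨ cong f (assoc x (y ⁻¹) z) ⟩
      f (x ∙ ((y ⁻¹) ∙ z))         ≡⟨ f-shift x∈ ⟩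
      f x ∙ w                      ≡⟨ cong (f x ∙_) (x⁻¹∙x∙y≡y (f y) w) ⟨
      f x ∙ ((f y ⁻¹) ∙ (f y ∙ w)) ≡⟨ cong (λ t → f x ∙ ((f y ⁻¹) ∙ t)) (f-shift y∈) ⟨
      f x ∙ ((f y ⁻¹) ∙ f (y ∙ ((y ⁻¹) ∙ z)))
                                   ≡⟨ cong (λ t → f x ∙ ((f y ⁻¹) ∙ f t)) (x∙x⁻¹∙y≡y y z) ⟩
      f x ∙ ((f y ⁻¹) ∙ f z)       ≡⟨ assoc (f x) (f y ⁻¹) (f z) ⟨
      (f x ∙ (f y ⁻¹)) ∙ f z       ∎

    D2-preserves : ∀ {f} → D2 L f → ∀ {x} → x ∈ L → f x ∈ L
    D2-preserves (gen ((f∈ , _) , _)) = f∈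
    D2-preserves idc = id
    D2-preserves (comp df dg) = D2-preserves df ∘ D2-preserves dg
    D2-preserves (invc _ g∈ _ _) = g∈
    D2-preserves (resp df f≈g) x∈ = subst (_∈ L) (f≈g x∈) (D2-preserves df x∈)

    -- Induction over the generation of `D2` calls for a property that survives products and
    -- inverses. Preserving or reversing the heap operation does, and unlike being an automorphism
    -- or an antiautomorphism it also holds for translations, which move `e`.
    D2⇒heapHom⊎heapAntihom : ∀ {f} → D2 L f → IsHeapHom L f ⊎ IsHeapAntihom L f
    D2⇒heapHom⊎heapAntihom (gen (_ , inj₁ normalizes)) =
      inj₁ (normalizesRight⇒heapHom normalizes)
    D2⇒heapHom⊎heapAntihom (gen {f} (_ , inj₂ f≈inv)) =
      inj₂ λ {x} {y} {z} x∈ y∈ z∈ → begin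
        f ((x ∙ (y ⁻¹)) ∙ z)              ≡⟨ f≈inv (heap-closed x∈ y∈ z∈) ⟩
        ((x ∙ (y ⁻¹)) ∙ z) ⁻¹             ≡⟨ heap-reverse x y z ⟩
        ((z ⁻¹) ∙ ((y ⁻¹) ⁻¹)) ∙ (x ⁻¹)   ≡⟨ heap-cong (f≈inv z∈) (f≈inv y∈) (f≈inv x∈) ⟨
        (f z ∙ (f y ⁻¹)) ∙ f x            ∎
    D2⇒heapHom⊎heapAntihom idc = inj₁ (λ _ _ _ → refl)
    D2⇒heapHom⊎heapAntihom (comp {f} {g} df dg)
      with D2⇒heapHom⊎heapAntihom df | D2⇒heapHom⊎heapAntihom dg
    ... | inj₁ hf | inj₁ hg = inj₁ λ x∈ y∈ z∈ →
      trans (cong f (hg x∈ y∈ z∈))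
            (hf (D2-preserves dg x∈) (D2-preserves dg y∈) (D2-preserves dg z∈))
    ... | inj₁ hf | inj₂ hg = inj₂ λ x∈ y∈ z∈ →
      trans (cong f (hg x∈ y∈ z∈))
            (hf (D2-preserves dg z∈) (D2-preserves dg y∈) (D2-preserves dg x∈))
    ... | inj₂ hf | inj₁ hg = inj₂ λ x∈ y∈ z∈ →
      trans (cong f (hg x∈ y∈ z∈))
            (hf (D2-preserves dg x∈) (D2-preserves dg y∈) (D2-preserves dg z∈))
    ... | inj₂ hf | inj₂ hg = inj₁ λ x∈ y∈ z∈ →
      trans (cong f (hg x∈ y∈ z∈))
            (hf (D2-preserves dg z∈) (D2-preserves dg y∈) (D2-preserves dg x∈))
    D2⇒heapHom⊎heapAntihom (invc {f} {g} df g∈ gf fg) with D2⇒heapHom⊎heapAntihom df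
    ... | inj₁ hf = inj₁ λ {x} {y} {z} x∈ y∈ z∈ → begin
      g ((x ∙ (y ⁻¹)) ∙ z)                     ≡⟨ cong g (heap-cong (fg x∈) (fg y∈) (fg z∈)) ⟨
      g ((f (g x) ∙ (f (g y) ⁻¹)) ∙ f (g z))   ≡⟨ cong g (hf (g∈ x∈) (g∈ y∈) (g∈ z∈)) ⟨
      g (f ((g x ∙ (g y ⁻¹)) ∙ g z))           ≡⟨ gf (heap-closed (g∈ x∈) (g∈ y∈) (g∈ z∈)) ⟩
      (g x ∙ (g y ⁻¹)) ∙ g z                   ∎
    ... | inj₂ hf = inj₂ λ {x} {y} {z} x∈ y∈ z∈ → begin
      g ((x ∙ (y ⁻¹)) ∙ z)                     ≡⟨ cong g (heap-cong (fg x∈) (fg y∈) (fg z∈)) ⟨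
      g ((f (g x) ∙ (f (g y) ⁻¹)) ∙ f (g z))   ≡⟨ cong g (hf (g∈ z∈) (g∈ y∈) (g∈ x∈)) ⟨
      g (f ((g z ∙ (g y ⁻¹)) ∙ g x))           ≡⟨ gf (heap-closed (g∈ z∈) (g∈ y∈) (g∈ x∈)) ⟩
      (g z ∙ (g y ⁻¹)) ∙ g x                   ∎
    D2⇒heapHom⊎heapAntihom (resp {f} {g} df f≈g) with D2⇒heapHom⊎heapAntihom df
    ... | inj₁ hf = inj₁ λ x∈ y∈ z∈ →
      trans (sym (f≈g (heap-closed x∈ y∈ z∈)))
            (trans (hf x∈ y∈ z∈) (heap-cong (f≈g x∈) (f≈g y∈) (f≈g z∈)))
    ... | inj₂ hf = inj₂ λ x∈ y∈ z∈ →
      trans (sym (f≈g (heap-closed x∈ y∈ z∈)))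
            (trans (hf x∈ y∈ z∈) (heap-cong (f≈g z∈) (f≈g y∈) (f≈g x∈)))

    private
      xy-as-heap : ∀ x y → x ∙ y ≡ (x ∙ (e ⁻¹)) ∙ y
      xy-as-heap x y = cong (_∙ y) (sym (trans (cong (x ∙_) ε⁻¹≈ε) (idʳ x)))

    -- `x ∙ y` is the heap value of `x`, `e`, `y`, and `f` fixes the middle entry.
    heapHom⇒hom : ∀ {f} → f e ≡ e → IsHeapHom L f →
                  ∀ {x y} → x ∈ L → y ∈ L → f (x ∙ y) ≡ f x ∙ f y
    heapHom⇒hom {f} fe hf {x} {y} x∈ y∈ = begin
      f (x ∙ y)                 ≡⟨ cong f (xy-as-heap x y) ⟩
      f ((x ∙ (e ⁻¹)) ∙ y)      ≡⟨ hf x∈ (proj₁ L-subgroup) y∈ ⟩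
      (f x ∙ (f e ⁻¹)) ∙ f y    ≡⟨ heap-cong refl fe refl ⟩
      (f x ∙ (e ⁻¹)) ∙ f y      ≡⟨ xy-as-heap (f x) (f y) ⟨
      f x ∙ f y                 ∎

    heapAntihom⇒antihom : ∀ {f} → f e ≡ e → IsHeapAntihom L f →
                          ∀ {x y} → x ∈ L → y ∈ L → f (x ∙ y) ≡ f y ∙ f x
    heapAntihom⇒antihom {f} fe hf {x} {y} x∈ y∈ = begin
      f (x ∙ y)                 ≡⟨ cong f (xy-as-heap x y) ⟩
      f ((x ∙ (e ⁻¹)) ∙ y)      ≡⟨ hf x∈ (proj₁ L-subgroup) y∈ ⟩
      (f y ∙ (f e ⁻¹)) ∙ f x    ≡⟨ heap-cong refl fe refl ⟩
      (f y ∙ (e ⁻¹)) ∙ f x      ≡⟨ xy-as-heap (f y) (f x) ⟨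
      f y ∙ f x                 ∎

  -- Elements and maps determined by conjugation on L.

  -- `p` and `q` conjugate each `y` to the same `y′`, so q⁻¹ p centralizes `A`. The hypothesis
  -- expresses equality of the two conjugates without inverses.
  same-action⇒≡ : ∀ {A} → TrivialCentralizer A → ∀ {p q} →
                  (∀ {y} → y ∈ A → ∃ λ y′ → p ∙ y ≡ y′ ∙ p × q ∙ y ≡ y′ ∙ q) → p ≡ q
  same-action⇒≡ {A} centralizer-trivial {p} {q} same = begin
    p                    ≡⟨ x∙x⁻¹∙y≡y q p ⟨
    q ∙ ((q ⁻¹) ∙ p)     ≡⟨ cong (q ∙_) (centralizer-trivial _ commutes) ⟩
    q ∙ e                ≡⟨ idʳ q ⟩
    q                    ∎
    where
    commutes : ((q ⁻¹) ∙ p) CommutesWith A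
    commutes y y∈ with same y∈
    ... | y′ , py , qy = begin
      ((q ⁻¹) ∙ p) ∙ y                  ≡⟨ assoc (q ⁻¹) p y ⟩
      (q ⁻¹) ∙ (p ∙ y)                  ≡⟨ cong ((q ⁻¹) ∙_) py ⟩
      (q ⁻¹) ∙ (y′ ∙ p)                 ≡⟨ cong (λ t → (q ⁻¹) ∙ (y′ ∙ t)) (x∙x⁻¹∙y≡y q p) ⟨
      (q ⁻¹) ∙ (y′ ∙ (q ∙ ((q ⁻¹) ∙ p))) ≡⟨ cong ((q ⁻¹) ∙_) (assoc y′ q _) ⟨
      (q ⁻¹) ∙ ((y′ ∙ q) ∙ ((q ⁻¹) ∙ p)) ≡⟨ cong (λ t → (q ⁻¹) ∙ (t ∙ ((q ⁻¹) ∙ p))) qy ⟨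
      (q ⁻¹) ∙ ((q ∙ y) ∙ ((q ⁻¹) ∙ p))  ≡⟨ cong ((q ⁻¹) ∙_) (assoc q y _) ⟩
      (q ⁻¹) ∙ (q ∙ (y ∙ ((q ⁻¹) ∙ p)))  ≡⟨ x⁻¹∙x∙y≡y q _ ⟩
      y ∙ ((q ⁻¹) ∙ p)                  ∎

  module _ {L U : Subset n}
           (L-conj : ∀ h {x} → x ∈ L → conj-of h x ∈ L)
           (L-centralizer : TrivialCentralizer L)
           (U-closed : ∀ {u v} → u ∈ U → v ∈ U → (u ∙ v) ∈ U)
           {f : Map}
           (f-onto-L : ∀ {y} → y ∈ L → ∃ λ x → x ∈ L × f x ≡ y)
           (f-left : ∀ {x u} → x ∈ L → u ∈ U → f (x ∙ u) ≡ f x ∙ f u)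
           (f-right : ∀ {x u} → x ∈ L → u ∈ U → f (u ∙ x) ≡ f u ∙ f x)
           where

    -- Compatibility with multiplication by `L` on both sides makes `f w` conjugate `f x` to the
    -- `f`-image of w x w⁻¹, for every `w ∈ U`. Hence `f (u ∙ v)` and `f u ∙ f v` act alike on f(L),
    -- which is all of `L`.
    bimodule-map⇒hom : ∀ {u v} → u ∈ U → v ∈ U → f (u ∙ v) ≡ f u ∙ f v
    bimodule-map⇒hom {u} {v} u∈ v∈ = same-action⇒≡ L-centralizer same
      where
      transport : ∀ {x w} → x ∈ L → w ∈ U → f w ∙ f x ≡ f (conj-of w x) ∙ f w
      transport {x} {w} x∈ w∈ = begin
        f w ∙ f x                ≡⟨ f-right x∈ w∈ ⟨
        f (w ∙ x)                ≡⟨ cong f (conj-slide w x) ⟨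
        f (conj-of w x ∙ w)      ≡⟨ f-left (L-conj w x∈) w∈ ⟩
        f (conj-of w x) ∙ f w    ∎

      conj-∙ : ∀ x → conj-of (u ∙ v) x ≡ conj-of u (conj-of v x)
      conj-∙ x = ∙-cancelʳ (u ∙ v) _ _ (begin
        conj-of (u ∙ v) x ∙ (u ∙ v)               ≡⟨ conj-slide (u ∙ v) x ⟩
        (u ∙ v) ∙ x                               ≡⟨ assoc u v x ⟩
        u ∙ (v ∙ x)                               ≡⟨ cong (u ∙_) (conj-slide v x) ⟨
        u ∙ (conj-of v x ∙ v)                     ≡⟨ assoc u _ v ⟨
        (u ∙ conj-of v x) ∙ v                     ≡⟨ cong (_∙ v) (conj-slide u _) ⟨
        (conj-of u (conj-of v x) ∙ u) ∙ v         ≡⟨ assoc _ u v ⟩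
        conj-of u (conj-of v x) ∙ (u ∙ v)         ∎)

      same : ∀ {y} → y ∈ L →
             ∃ λ y′ → f (u ∙ v) ∙ y ≡ y′ ∙ f (u ∙ v) × (f u ∙ f v) ∙ y ≡ y′ ∙ (f u ∙ f v)
      same y∈ with f-onto-L y∈
      ... | x , x∈ , refl =
        f (conj-of (u ∙ v) x) , transport x∈ (U-closed u∈ v∈) , (begin
          (f u ∙ f v) ∙ f x                           ≡⟨ assoc _ _ _ ⟩
          f u ∙ (f v ∙ f x)                           ≡⟨ cong (f u ∙_) (transport x∈ v∈) ⟩
          f u ∙ (f (conj-of v x) ∙ f v)               ≡⟨ assoc _ _ _ ⟨
          (f u ∙ f (conj-of v x)) ∙ f v               ≡⟨ cong (_∙ f v) (transport (L-conj v x∈) u∈) ⟩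
          (f (conj-of u (conj-of v x)) ∙ f u) ∙ f v   ≡⟨ assoc _ _ _ ⟩
          f (conj-of u (conj-of v x)) ∙ (f u ∙ f v)   ≡⟨ cong (λ t → f t ∙ (f u ∙ f v)) (conj-∙ x) ⟨
          f (conj-of (u ∙ v) x) ∙ (f u ∙ f v)         ∎)

  -- Some elements of D(2,U).

  isPermOn-∘ : ∀ {S f g} → IsPermOn S f → IsPermOn S g → IsPermOn S (f ∘ g)
  isPermOn-∘ {f = f} (f∈ , f′ , f′∈ , f′f , ff′) (g∈ , g′ , g′∈ , g′g , gg′) =
    (f∈ ∘ g∈) , g′ ∘ f′ , (g′∈ ∘ f′∈)
    , (λ x∈ → trans (cong g′ (f′f (g∈ x∈))) (g′g x∈))
    , (λ x∈ → trans (cong f (gg′ (f′∈ x∈))) (ff′ x∈))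

  module _ {U : Subset n} (U-subgroup : IsSubgroup U) where

    inverse-isPermOn : IsPermOn (_∈ U) _⁻¹
    inverse-isPermOn =
      proj₂ (proj₂ U-subgroup) , _⁻¹ , proj₂ (proj₂ U-subgroup)
      , (λ {x} _ → ⁻¹-involutive x) , (λ {x} _ → ⁻¹-involutive x)

    hom∈D2 : ∀ {f} → IsPermOn (_∈ U) f →
             (∀ {u v} → u ∈ U → v ∈ U → f (u ∙ v) ≡ f u ∙ f v) → D2 U f
    hom∈D2 {f} f-perm@(f∈ , f′ , f′∈ , _ , ff′) f-hom = gen (f-perm , inj₁
      ( (λ {x} x∈ → f x , f∈ x∈ , λ u∈ → f-hom u∈ x∈)
      , (λ {y} y∈ → f′ y , f′∈ y∈ , λ {u} u∈ →
           trans (f-hom u∈ (f′∈ y∈)) (cong (f u ∙_) (ff′ y∈)))))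

    inverse∈D2 : D2 U _⁻¹
    inverse∈D2 = gen (inverse-isPermOn , inj₂ (λ _ → refl))

    -- By associativity, left translations commute with right translations, so they normalize the
    -- group of right translations.
    λ′∈D2 : ∀ {a} → a ∈ U → D2 U (λ′ a)
    λ′∈D2 {a} a∈ = gen
      ( ( closed a∈ , λ′ (a ⁻¹) , closed (proj₂ (proj₂ U-subgroup) a∈)
        , (λ {x} _ → x⁻¹∙x∙y≡y a x) , (λ {x} _ → x∙x⁻¹∙y≡y a x))
      , inj₁ ( (λ {x} x∈ → x , x∈ , λ {u} _ → sym (assoc a u x))
             , (λ {x} x∈ → x , x∈ , λ {u} _ → sym (assoc a u x))))
      where
      closed : ∀ {x y} → x ∈ U → y ∈ U → (x ∙ y) ∈ U
      closed = proj₁ (proj₂ U-subgroup)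

  -- The group K and its blocks containing the identity.

  module _ (K : Map → Set) (K-group : IsPermGroup K) (G*≤K : ContainsStar K) where

    K-∘ : ∀ {f g} → K f → K g → K (f ∘ g)
    K-∘ = proj₁ (proj₂ (proj₂ K-group))

    K-resp : ∀ {f g} → K f → (∀ x → f x ≡ g x) → K g
    K-resp = proj₂ (proj₂ (proj₂ (proj₂ K-group)))

    K-inverse : ∀ {f} → K f → ∃ λ g → K g × (∀ x → g (f x) ≡ x) × (∀ x → f (g x) ≡ x)
    K-inverse {f} Kf with proj₁ K-group Kf
    ... | _ , g , _ , gf , fg =
      g , proj₁ (proj₂ (proj₂ (proj₂ K-group))) Kf (λ _ → gf tt) (λ _ → fg tt)
      , (λ _ → gf tt) , (λ _ → fg tt)

    K-λ′ : ∀ a → K (λ′ a)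
    K-λ′ a = K-resp (G*≤K a e) (λ x → cong (a ∙_) (idʳ x))

    K-ρ : ∀ a → K (ρ a)
    K-ρ a = K-resp (G*≤K e a) (λ x → idˡ (x ∙ a))

    stabilizes⇒isPermOn : ∀ {B f} → K f → Stabilizes (_∈ B) f → IsPermOn (_∈ B) f
    stabilizes⇒isPermOn {B} Kf stab with K-inverse Kf
    ... | g , _ , gf , fg =
      (λ {x} → proj₁ (stab x)) , g
      , (λ {x} x∈ → proj₂ (stab (g x)) (subst (_∈ B) (sym (fg x)) x∈))
      , (λ {x} _ → gf x) , (λ {x} _ → fg x)

    module Block {B : Subset n} (B-block : IsBlock K B) (e∈B : e ∈ B) where

      stabilizes : ∀ {k} → K k → ∀ {x} → x ∈ B → k x ∈ B → Stabilizes (_∈ B) k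
      stabilizes Kk {x} x∈ kx∈ = proj₂ B-block _ Kk (x , x∈ , kx∈)

      -- Left translation by `x` lies in `K` and moves `e` to `x`, both in `B`, so it stabilizes the
      -- block.
      closed : ∀ {x y} → x ∈ B → y ∈ B → (x ∙ y) ∈ B
      closed {x} {y} x∈ =
        proj₁ (stabilizes (K-λ′ x) e∈B (subst (_∈ B) (sym (idʳ x)) x∈) y)

      inverse : ∀ {x} → x ∈ B → (x ⁻¹) ∈ B
      inverse {x} x∈ = subst (_∈ B) (idʳ (x ⁻¹))
        (proj₁ (stabilizes (K-λ′ (x ⁻¹)) x∈ (subst (_∈ B) (sym (invˡ x)) e∈B) e) e∈B)

      subgroup : IsSubgroup B
      subgroup = e∈B , closed , inverse

      -- Conjugation by `h` belongs to G* and fixes `e ∈ B`, so it stabilizes the block.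
      conj : ∀ h {x} → x ∈ B → conj-of h x ∈ B
      conj h {x} = subst (_∈ B) (sym (assoc h x (h ⁻¹))) ∘ proj₁ (stabilizes (G*≤K h (h ⁻¹)) e∈B
        (subst (_∈ B) (sym (trans (cong (h ∙_) (idˡ (h ⁻¹))) (invʳ h))) e∈B) x)

      normal : IsNormalIn ⊤ B
      normal = subgroup , (λ _ → ∈⊤) , λ {h} _ → conj h

    -- The minimal block L, its cosets, and the kernel K_𝔏.

    module MinimalBlock {L : Subset n} (L-min : IsMinimalBlock K L) where

      e∈L : e ∈ L
      e∈L = proj₂ (L-min e) (λ _ _ e∈ _ → e∈)

      -- If `k` moves a point of `L` into `L`, then it stabilizes each of the blocks whose
      -- intersection is `L`, and hence the intersection.
      L-block : IsBlock K L
      L-block = (e , e∈L) , λ k Kk → λ where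
        (x , x∈ , kx∈) y →
          let B-stab : ∀ B → IsBlock K B → e ∈ B → _ → Stabilizes (_∈ B) k
              B-stab B b eB nt = proj₂ b k Kk
                (x , proj₁ (L-min x) x∈ B b eB nt , proj₁ (L-min (k x)) kx∈ B b eB nt)
          in (λ y∈ → proj₂ (L-min (k y)) λ B b eB nt →
                proj₁ (B-stab B b eB nt y) (proj₁ (L-min y) y∈ B b eB nt))
           , (λ ky∈ → proj₂ (L-min y) λ B b eB nt →
                proj₂ (B-stab B b eB nt y) (proj₁ (L-min (k y)) ky∈ B b eB nt))

      open Block L-block e∈L public

      -- Every block that contains `e` and has two distinct elements is a nontrivial normal
      -- subgroup, so `S` lies in each block of the intersection.
      socle⊆L : ∀ {S} → (∀ {x} → Soc ⊤ x → x ∈ S) → Simple S → S ⊆ L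
      socle⊆L Soc⊆S S-simple {x} x∈ = proj₂ (L-min x) λ where
        B b eB (a , a′ , a∈ , a′∈ , a≢a′) →
          socle⊆normal Soc⊆S S-simple (Block.normal b eB)
            (decidable-stable (nontrivial? B) λ ¬nt →
              a≢a′ (trans (¬nontrivial⇒trivial ¬nt a∈) (sym (¬nontrivial⇒trivial ¬nt a′∈))))
            x∈

      Coset : Carrier → Carrier → Set
      Coset a y = ((a ⁻¹) ∙ y) ∈ L

      a∈Coset-a : ∀ a → Coset a a
      a∈Coset-a a = subst (_∈ L) (sym (invˡ a)) e∈L

      ∈L⇒Coset-e : ∀ {x} → x ∈ L → Coset e x
      ∈L⇒Coset-e {x} = subst (_∈ L) (sym (trans (cong (_∙ x) ε⁻¹≈ε) (idˡ x)))

      Coset-e⇒∈L : ∀ {x} → Coset e x → x ∈ L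
      Coset-e⇒∈L {x} = subst (_∈ L) (trans (cong (_∙ x) ε⁻¹≈ε) (idˡ x))

      -- Since `k z` is `a`, the map x ↦ a⁻¹ (k x) sends `z ∈ L` to `e`, and so stabilizes `L`.
      -- Blocks of 𝔏 can thus be named by any of their points instead of by a map in `K`.
      Img⇔Coset : ∀ {k a} → K k → Img L k a → ∀ y → Img L k y ⇔ Coset a y
      Img⇔Coset {k} {a} Kk (z , z∈ , refl) y =
        (λ where (w , w∈ , refl) → proj₁ (stab w) w∈)
        , back
        where
        stab : Stabilizes (_∈ L) (λ′ (a ⁻¹) ∘ k)
        stab = stabilizes (K-∘ (K-λ′ (a ⁻¹)) Kk) z∈ (a∈Coset-a a)
        back : Coset a y → Img L k y
        back y∈ with K-inverse Kk
        ... | k′ , _ , _ , kk′ =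
          k′ y , proj₂ (stab (k′ y)) (subst (Coset a) (sym (kk′ y)) y∈) , kk′ y

      -- The condition on `h` puts `h y` in the coset y L, so each point stays in its own block.
      right-shift∈KL : ∀ {h} → K h → (∀ y → ((y ⁻¹) ∙ h y) ∈ L) → InKL K L h
      right-shift∈KL {h} Kh shift = Kh , λ k Kk y →
        let coset : ∀ z → Img L k z ⇔ Coset (k e) z
            coset = Img⇔Coset Kk (e , e∈L , refl)
        in (λ y∈ → proj₂ (coset (h y)) (forth (proj₁ (coset y) y∈)))
         , (λ hy∈ → proj₂ (coset y) (back (proj₁ (coset (h y)) hy∈)))
        where
        factor : ∀ a y → (a ⁻¹) ∙ h y ≡ ((a ⁻¹) ∙ y) ∙ ((y ⁻¹) ∙ h y)
        factor a y = sym (trans (assoc _ _ _) (cong ((a ⁻¹) ∙_) (x∙x⁻¹∙y≡y y (h y))))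
        forth : ∀ {a y} → Coset a y → Coset a (h y)
        forth {a} {y} y∈ = subst (_∈ L) (sym (factor a y)) (closed y∈ (shift y))
        back : ∀ {a y} → Coset a (h y) → Coset a y
        back {a} {y} hy∈ = subst (_∈ L)
          (trans (cong (_∙ (((y ⁻¹) ∙ h y) ⁻¹)) (factor a y)) (y∙x∙x⁻¹≡y _ _))
          (closed hy∈ (inverse (shift y)))

      ρ∈KL : ∀ {x} → x ∈ L → InKL K L (ρ x)
      ρ∈KL {x} x∈ = right-shift∈KL (K-ρ x) λ y → subst (_∈ L) (sym (x⁻¹∙x∙y≡y y x)) x∈

      -- Normality of `L` puts y⁻¹ x y in `L`, so `x ∙ y` lies in the coset y L.
      λ′∈KL : ∀ {x} → x ∈ L → InKL K L (λ′ x)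
      λ′∈KL {x} x∈ = right-shift∈KL (K-λ′ x) λ y →
        subst (_∈ L) (trans (assoc _ _ _) (cong (λ t → (y ⁻¹) ∙ (x ∙ t)) (⁻¹-involutive y)))
          (conj (y ⁻¹) x∈)

      -- `k′` takes the block g(L) to the block of `k′ ∘ g`, which `h` fixes, and `k` brings it
      -- back. This is the normality of K_𝔏 in `K`.
      conj∈KL : ∀ {h k k′} → InKL K L h → K k → K k′ →
                (∀ x → k′ (k x) ≡ x) → (∀ x → k (k′ x) ≡ x) → InKL K L (k ∘ h ∘ k′)
      conj∈KL {h} {k} {k′} (Kh , h-stab) Kk Kk′ k′k kk′ =
        K-∘ Kk (K-∘ Kh Kk′) , λ g Kg x →
          let stab = h-stab (k′ ∘ g) (K-∘ Kk′ Kg) (k′ x)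
          in (λ x∈ → push g (proj₁ stab (pull g x∈)))
           , (λ x∈ → unpull g (proj₂ stab (unpush g x∈)))
        where
        pull : ∀ g {x} → Img L g x → Img L (k′ ∘ g) (k′ x)
        pull g (y , y∈ , gy) = y , y∈ , cong k′ gy
        push : ∀ g {x} → Img L (k′ ∘ g) x → Img L g (k x)
        push g (y , y∈ , gy) = y , y∈ , trans (sym (kk′ (g y))) (cong k gy)
        unpull : ∀ g {x} → Img L (k′ ∘ g) (k′ x) → Img L g x
        unpull g {x} i = subst (Img L g) (kk′ x) (push g i)
        unpush : ∀ g {x} → Img L g (k x) → Img L (k′ ∘ g) x
        unpush g {x} i = subst (Img L (k′ ∘ g)) (k′k x) (pull g i)

      -- One half of the relation ∼ between the blocks a L and b L: restriction to a L is injective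
      -- on the group that K_𝔏 induces on their union.
      Determines : Carrier → Carrier → Set
      Determines a b = ∀ {h₁ h₂} → InKL K L h₁ → InKL K L h₂ →
                       h₁ ≈[ Coset a ] h₂ → h₁ ≈[ Coset b ] h₂

      -- Left translation by `c` maps a L to the coset of `c ∙ a`, and conjugation by it preserves
      -- K_𝔏. Pulling `h₁` and `h₂` back along it reduces the claim to `a` and `b`.
      determines-λ′ : ∀ c {a b} → Determines a b → Determines (c ∙ a) (c ∙ b)
      determines-λ′ c {a} {b} det {h₁} {h₂} H₁ H₂ agree {y} y∈ = begin
        h₁ y                                  ≡⟨ x∙x⁻¹∙y≡y c _ ⟨
        c ∙ ((c ⁻¹) ∙ h₁ y)                   ≡⟨ cong (λ t → c ∙ ((c ⁻¹) ∙ h₁ t)) (x∙x⁻¹∙y≡y c y) ⟨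
        c ∙ ((c ⁻¹) ∙ h₁ (c ∙ ((c ⁻¹) ∙ y)))  ≡⟨ cong (c ∙_) (det (shifted H₁) (shifted H₂) agree′ y∈′) ⟩
        c ∙ ((c ⁻¹) ∙ h₂ (c ∙ ((c ⁻¹) ∙ y)))  ≡⟨ cong (λ t → c ∙ ((c ⁻¹) ∙ h₂ t)) (x∙x⁻¹∙y≡y c y) ⟩
        c ∙ ((c ⁻¹) ∙ h₂ y)                   ≡⟨ x∙x⁻¹∙y≡y c _ ⟩
        h₂ y                                  ∎
        where
        shifted : ∀ {h} → InKL K L h → InKL K L (λ′ (c ⁻¹) ∘ h ∘ λ′ c)
        shifted H = conj∈KL H (K-λ′ (c ⁻¹)) (K-λ′ c) (x∙x⁻¹∙y≡y c) (x⁻¹∙x∙y≡y c)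
        shift-rep : ∀ d z → ((c ∙ d) ⁻¹) ∙ z ≡ (d ⁻¹) ∙ ((c ⁻¹) ∙ z)
        shift-rep d z = trans (cong (_∙ z) (⁻¹-anti-homo-∙ c d)) (assoc _ _ _)
        agree′ : (λ′ (c ⁻¹) ∘ h₁ ∘ λ′ c) ≈[ Coset a ] (λ′ (c ⁻¹) ∘ h₂ ∘ λ′ c)
        agree′ {z} z∈ = cong ((c ⁻¹) ∙_) (agree (subst (_∈ L) (sym (trans (shift-rep a (c ∙ z))
          (cong ((a ⁻¹) ∙_) (x⁻¹∙x∙y≡y c z)))) z∈))
        y∈′ : Coset b ((c ⁻¹) ∙ y)
        y∈′ = subst (_∈ L) (shift-rep b y) y∈

      -- The subgroup U of the principal section.

      module PrincipalSection {U : Subset n} (U-principal : IsPrincipalU K L U) where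

        ∈U⁻ : ∀ {a} → a ∈ U → Determines a e × Determines e a
        ∈U⁻ {a} a∈ with proj₁ (U-principal a) a∈
        ... | k , Kk , (k→id , id→k) , a∈kL =
          (λ H₁ H₂ agree {y} y∈ →
            k→id _ _ H₁ H₂ (λ {z} z∈ → agree (proj₁ (kL z) z∈)) (inj₂ (y , Coset-e⇒∈L y∈ , refl)))
          , (λ H₁ H₂ agree {y} y∈ →
            id→k _ _ H₁ H₂ (λ where (z , z∈ , refl) → agree (∈L⇒Coset-e z∈))
              (inj₂ (proj₂ (kL y) y∈)))
          where
          kL : ∀ y → Img L k y ⇔ Coset a y
          kL = Img⇔Coset Kk a∈kL

        ∈U⁺ : ∀ {a} → Determines a e → Determines e a → a ∈ U
        ∈U⁺ {a} a→e e→a = proj₂ (U-principal a)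
          -- Left translation by `a` serves as the element of `K` that carries `L` to the block of
          -- `a`.
          ( λ′ a , K-λ′ a
          , ( (λ _ _ H₁ H₂ agree → λ where
                (inj₁ y∈) → agree y∈
                (inj₂ (y , y∈ , refl)) →
                  a→e H₁ H₂ (λ {z} z∈ → agree (proj₂ (aL z) z∈)) (∈L⇒Coset-e y∈))
            , (λ _ _ H₁ H₂ agree → λ where
                (inj₁ y∈) → agree y∈
                {y} (inj₂ y∈) →
                  e→a H₁ H₂ (λ {z} z∈ → agree (z , Coset-e⇒∈L z∈ , refl)) (proj₁ (aL y) y∈)))
          , a∈aL)
          where
          a∈aL : Img L (λ′ a) a
          a∈aL = e , e∈L , idʳ a
          aL : ∀ y → Img L (λ′ a) y ⇔ Coset a y
          aL = Img⇔Coset (K-λ′ a) a∈aL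

        -- Translating the relation between b L and L by `a` relates a b L to a L; transitivity
        -- through a L then reaches L.
        U-closed : ∀ {a b} → a ∈ U → b ∈ U → (a ∙ b) ∈ U
        U-closed {a} {b} a∈ b∈ = ∈U⁺
          (λ H₁ H₂ → proj₁ (∈U⁻ a∈) H₁ H₂ ∘ ab→a H₁ H₂)
          (λ H₁ H₂ → a→ab H₁ H₂ ∘ proj₂ (∈U⁻ a∈) H₁ H₂)
          where
          ab→a : Determines (a ∙ b) a
          ab→a = subst (Determines (a ∙ b)) (idʳ a) (determines-λ′ a (proj₁ (∈U⁻ b∈)))
          a→ab : Determines a (a ∙ b)
          a→ab = subst (λ t → Determines t (a ∙ b)) (idʳ a) (determines-λ′ a (proj₂ (∈U⁻ b∈)))

        U-subgroup : IsSubgroup U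
        U-subgroup =
          ∈U⁺ (λ _ _ → id) (λ _ _ → id)
          , U-closed
          -- Translation by a⁻¹ turns the relation between e and a into one between a⁻¹ and e.
          , λ {a} a∈ → ∈U⁺
              (subst₂ Determines (idʳ (a ⁻¹)) (invˡ a) (determines-λ′ (a ⁻¹) (proj₂ (∈U⁻ a∈))))
              (subst₂ Determines (invˡ a) (idʳ (a ⁻¹)) (determines-λ′ (a ⁻¹) (proj₁ (∈U⁻ a∈))))

        -- f h f⁻¹ and `h′` both lie in K_𝔏 and agree on `L`, so they agree on every block inside
        -- `U`, in particular at `f u`.
        intertwine-on-U : ∀ {f h h′} → K f → Stabilizes (_∈ L) f → Stabilizes (_∈ U) f →
                          InKL K L h → InKL K L h′ →
                          (∀ {x} → x ∈ L → f (h x) ≡ h′ (f x)) →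
                          ∀ {u} → u ∈ U → f (h u) ≡ h′ (f u)
        intertwine-on-U {f} {h} {h′} Kf f-L f-U H H′ on-L {u} u∈ with K-inverse Kf
        ... | f′ , Kf′ , f′f , ff′ = begin
          f (h u)            ≡⟨ cong (f ∘ h) (f′f u) ⟨
          f (h (f′ (f u)))   ≡⟨ proj₂ (∈U⁻ (proj₁ (f-U u) u∈)) (conj∈KL H Kf Kf′ f′f ff′) H′ agree
                                  (a∈Coset-a (f u)) ⟩
          h′ (f u)           ∎
          where
          agree : (f ∘ h ∘ f′) ≈[ Coset e ] h′
          agree {x} x∈ = trans
            (on-L (proj₂ (f-L (f′ x)) (subst (_∈ L) (sym (ff′ x)) (Coset-e⇒∈L x∈))))
            (cong h′ (ff′ x))

        -- Passage from L to U.

        module _ (L-centralizer : TrivialCentralizer L) {f : Map} (Kf : K f)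
                 (f-L : Stabilizes (_∈ L) f) (f-U : Stabilizes (_∈ U) f) where
          private
            onto-L : ∀ {y} → y ∈ L → ∃ λ x → x ∈ L × f x ≡ y
            onto-L {y} y∈ with stabilizes⇒isPermOn {L} Kf f-L
            ... | _ , f′ , f′∈ , _ , ff′ = f′ y , f′∈ y∈ , ff′ y∈

            f∈L : ∀ {x} → x ∈ L → f x ∈ L
            f∈L {x} = proj₁ (f-L x)

            f-perm-U : IsPermOn (_∈ U) f
            f-perm-U = stabilizes⇒isPermOn Kf f-U

          hom-on-L⇒D2 : (∀ {x y} → x ∈ L → y ∈ L → f (x ∙ y) ≡ f x ∙ f y) → D2 U f
          hom-on-L⇒D2 hom = hom∈D2 U-subgroup f-perm-U
            (bimodule-map⇒hom conj L-centralizer U-closed onto-L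
              (λ x∈ → intertwine-on-U Kf f-L f-U (λ′∈KL x∈) (λ′∈KL (f∈L x∈)) (hom x∈))
              (λ x∈ → intertwine-on-U Kf f-L f-U (ρ∈KL x∈) (ρ∈KL (f∈L x∈)) (λ z∈ → hom z∈ x∈)))

          -- On `L`, the map `f` intertwines left multiplications with right ones. The intertwining
          -- is extended to `U` for `f` itself, since x ↦ (f x)⁻¹ may lie outside `K`; inverting
          -- afterwards restores the sides, and a second inversion recovers `f`.
          antihom-on-L⇒D2 : (∀ {x y} → x ∈ L → y ∈ L → f (x ∙ y) ≡ f y ∙ f x) → D2 U f
          antihom-on-L⇒D2 antihom = resp
            (comp (inverse∈D2 U-subgroup)
              (hom∈D2 U-subgroup (isPermOn-∘ (inverse-isPermOn U-subgroup) f-perm-U)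
                (bimodule-map⇒hom conj L-centralizer U-closed onto-L′
                  (λ {x} {u} x∈ u∈ → trans
                    (cong _⁻¹ (intertwine-on-U Kf f-L f-U (λ′∈KL x∈) (ρ∈KL (f∈L x∈)) (antihom x∈) u∈))
                    (⁻¹-anti-homo-∙ (f u) (f x)))
                  (λ {x} {u} x∈ u∈ → trans
                    (cong _⁻¹ (intertwine-on-U Kf f-L f-U (ρ∈KL x∈) (λ′∈KL (f∈L x∈))
                      (λ z∈ → antihom z∈ x∈) u∈))
                    (⁻¹-anti-homo-∙ (f x) (f u))))))
            (λ {x} _ → ⁻¹-involutive (f x))
            where
            onto-L′ : ∀ {y} → y ∈ L → ∃ λ x → x ∈ L × (f x ⁻¹) ≡ y
            onto-L′ {y} y∈ with onto-L (inverse y∈)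
            ... | x , x∈ , fx = x , x∈ , trans (cong _⁻¹ fx) (⁻¹-involutive y)

        -- `k` may move `L` to another block in `U`. Following it by left translation by (k e)⁻¹
        -- gives an element `f` of `K` that fixes `e` and so stabilizes `L`, where the hypothesis on
        -- `L` applies. As `k e ∈ U`, the translation back lies in `D2 U`.
        principal-section : TrivialCentralizer L → InducedIn K (_∈ L) (D2 L) →
                            InducedIn K (_∈ U) (D2 U)
        principal-section L-centralizer K^L≤D2 k Kk k-U =
          resp (comp (λ′∈D2 U-subgroup a∈) f∈D2) (λ {x} _ → x∙x⁻¹∙y≡y a (k x))
          where
          a : Carrier
          a = k e
          f : Map
          f = λ′ (a ⁻¹) ∘ k
          a∈ : a ∈ U
          a∈ = proj₁ (k-U e) (proj₁ U-subgroup)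
          Kf : K f
          Kf = K-∘ (K-λ′ (a ⁻¹)) Kk
          f-L : Stabilizes (_∈ L) f
          f-L = stabilizes Kf e∈L (a∈Coset-a a)
          f-U : Stabilizes (_∈ U) f
          f-U x =
            (λ x∈ → U-closed (proj₂ (proj₂ U-subgroup) a∈) (proj₁ (k-U x) x∈))
            , (λ fx∈ → proj₂ (k-U x) (subst (_∈ U) (x∙x⁻¹∙y≡y a (k x)) (U-closed a∈ fx∈)))
          f∈D2 : D2 U f
          f∈D2 with D2⇒heapHom⊎heapAntihom subgroup (K^L≤D2 f Kf f-L)
          ... | inj₁ hom = hom-on-L⇒D2 L-centralizer Kf f-L f-U
                             (heapHom⇒hom subgroup (invˡ a) hom)
          ... | inj₂ anti = antihom-on-L⇒D2 L-centralizer Kf f-L f-U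
                              (heapAntihom⇒antihom subgroup (invˡ a) anti)

theorem6p3 : (G : FinGroup) → let open Over G in
    (K : Map → Set) → IsPermGroup K → ContainsStar K → TwoClosed K →
    AlmostSimple →
    (L U : Subset n) → IsMinimalBlock K L → IsPrincipalU K L U →
    NormalType K L →
    InducedIn K (_∈ U) (D2 U)
theorem6p3 G K K-group G*≤K _ (S , S≡Soc , S-simple , x , y , x∈ , y∈ , xy≢yx)
           L U L-min U-principal (_ , K^L≤D2) =
  principal-section
    (normal⊇socle⇒trivialCentralizer G Soc⊆S S-simple normal (socle⊆L Soc⊆S S-simple)
      x∈ y∈ xy≢yx)
    K^L≤D2
  where
  open Over G
  open MinimalBlock G K K-group G*≤K L-min
  open PrincipalSection U-principal
  Soc⊆S : ∀ {s} → Soc ⊤ s → s ∈ S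
  Soc⊆S {s} = proj₂ (S≡Soc s)
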